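{- $$\prod_{n=1}^{\infty}\begin{pmatrix}\frac{n}{2(2n+1)} & \frac{3}{2n}\\ 0 & 1\end{pmatrix}=\begin{pmatrix}0 & \zeta(2)\\ 0 & 1\end{pmatrix}.$$
   Context: $\zeta(s)=\sum_{n\geqslant1}n^{ -s}$ is the Riemann zeta function. The infinite product $\prod_{n=1}^\infty \mathbf{M}_n$ of square matrices means the entrywise limit as $m\to\infty$ of the ordered products $\mathbf{M}_1\mathbf{M}_2\cdots\mathbf{M}_m$ (factors multiplied from left to right in increasing index). -}

module Defs where

open import Algebra.Properties.CommutativeMonoid.Sum using (sum)
open import Data.Bool.Base using (if_then_else_)
import Data.Fin.Properties as Fin
open import Data.Integer.Base as ℤ using (+_)
import Data.Integer.Properties as ℤ
open import Data.Nat.Base as ℕ using (ℕ; zero; suc; NonZero; NonTrivial)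
import Data.Nat.Properties as ℕ
open import Data.Product.Base using (_,_; ∃-syntax)
open import Data.Rational.Base as ℚ using (ℚ; mkℚ; 0ℚ; 1ℚ; ½; _/_; ↧ₙ_)
import Data.Rational.Properties as ℚ
import Data.Rational.Solver as ℚSolver
import Data.Rational.Unnormalised.Base as ℚᵘ
import Data.Rational.Unnormalised.Properties as ℚᵘ
open import Data.Sum.Base using (inj₁; inj₂)
open import Data.Vec.Functional using (Vector; []; _∷_)
open import Function.Base using (it)
open import Relation.Binary.PropositionalEquality
open import Relation.Nullary.Decidable.Core using (⌊_⌋)

------------------------------------------------------------------------
-- Facts about ℚ used to build Cauchy sequences

private
  ∣p∣≤ : ∀ {p q} → p ℚ.≤ q → ℚ.- p ℚ.≤ q → ℚ.∣ p ∣ ℚ.≤ q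
  ∣p∣≤ {p} {q} p≤q -p≤q with ℚ.∣p∣≡p∨∣p∣≡-p p
  ... | inj₁ eq = subst (ℚ._≤ q) (sym eq) p≤q
  ... | inj₂ eq = subst (ℚ._≤ q) (sym eq) -p≤q

  ∣p-q∣≡∣q-p∣ : ∀ p q → ℚ.∣ p ℚ.- q ∣ ≡ ℚ.∣ q ℚ.- p ∣
  ∣p-q∣≡∣q-p∣ p q = trans (sym (ℚ.∣-p∣≡∣p∣ (p ℚ.- q))) (cong ℚ.∣_∣
    (solve 2 (λ p q → :- (p :- q) := q :- p) refl p q))
    where open ℚSolver.+-*-Solver

  p≤q+r⇒p-q≤r : ∀ {p q r} → p ℚ.≤ q ℚ.+ r → p ℚ.- q ℚ.≤ r
  p≤q+r⇒p-q≤r {p} {q} {r} h = subst (p ℚ.- q ℚ.≤_)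
    (solve 2 (λ q r → (q :+ r) :- q := r) refl q r)
    (ℚ.+-monoˡ-≤ (ℚ.- q) h)
    where open ℚSolver.+-*-Solver

  ∣p∣-∣q∣≤∣p-q∣ : ∀ p q → ℚ.∣ p ∣ ℚ.- ℚ.∣ q ∣ ℚ.≤ ℚ.∣ p ℚ.- q ∣
  ∣p∣-∣q∣≤∣p-q∣ p q = p≤q+r⇒p-q≤r (subst (λ t → ℚ.∣ t ∣ ℚ.≤ ℚ.∣ q ∣ ℚ.+ ℚ.∣ p ℚ.- q ∣)
    (solve 2 (λ p q → q :+ (p :- q) := p) refl p q)
    (ℚ.∣p+q∣≤∣p∣+∣q∣ q (p ℚ.- q)))
    where open ℚSolver.+-*-Solver

  ∣∣p∣-∣q∣∣≤∣p-q∣ : ∀ p q → ℚ.∣ ℚ.∣ p ∣ ℚ.- ℚ.∣ q ∣ ∣ ℚ.≤ ℚ.∣ p ℚ.- q ∣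
  ∣∣p∣-∣q∣∣≤∣p-q∣ p q = ∣p∣≤ (∣p∣-∣q∣≤∣p-q∣ p q) (subst₂ ℚ._≤_
    (solve 2 (λ a b → b :- a := :- (a :- b)) refl ℚ.∣ p ∣ ℚ.∣ q ∣)
    (∣p-q∣≡∣q-p∣ q p) (∣p∣-∣q∣≤∣p-q∣ q p))
    where open ℚSolver.+-*-Solver

  0<½*ε : ∀ {ε} → 0ℚ ℚ.< ε → 0ℚ ℚ.< ½ ℚ.* ε
  0<½*ε {ε} 0<ε = subst (ℚ._< ½ ℚ.* ε) (ℚ.*-zeroʳ ½) (ℚ.*-monoʳ-<-pos ½ 0<ε)

  ½*ε+½*ε≡ε : ∀ ε → ½ ℚ.* ε ℚ.+ ½ ℚ.* ε ≡ ε
  ½*ε+½*ε≡ε = solve 1 (λ ε → con ½ :* ε :+ con ½ :* ε := ε) refl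
    where open ℚSolver.+-*-Solver

  1/↧ε≤ε : ∀ ε → 0ℚ ℚ.< ε → + 1 / ↧ₙ ε ℚ.≤ ε
  1/↧ε≤ε ε@(mkℚ (+ suc n) d _) _ = ℚ.toℚᵘ-cancel-≤
    (ℚᵘ.≤-trans (ℚᵘ.≤-reflexive (ℚ.toℚᵘ-fromℚᵘ (ℚᵘ.mkℚᵘ (+ 1) d)))
      (ℚᵘ.*≤* (ℤ.+≤+ (ℕ.*-monoˡ-≤ (suc d) (ℕ.s≤s (ℕ.z≤n {n}))))))
  1/↧ε≤ε (mkℚ (+ zero) _ _) (ℚ.*<* (ℤ.+<+ ()))
  1/↧ε≤ε (mkℚ ℤ.-[1+ _ ] _ _) (ℚ.*<* ())

------------------------------------------------------------------------
-- Real numbers, as Cauchy sequences of rationals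

IsCauchy : (ℕ → ℚ) → Set
IsCauchy x = ∀ ε → 0ℚ ℚ.< ε →
  ∃[ N ] (∀ m n → N ℕ.≤ m → N ℕ.≤ n → ℚ.∣ x m ℚ.- x n ∣ ℚ.≤ ε)

record ℝ : Set where
  constructor mkℝ
  field
    seq    : ℕ → ℚ
    cauchy : IsCauchy seq

open ℝ public

infixl 6 _-_
infix  4 _≤_ _⟶_

fromℚ : ℚ → ℝ
fromℚ q = mkℝ (λ _ → q) λ ε 0<ε → 0 , λ _ _ _ _ →
  subst (λ t → ℚ.∣ t ∣ ℚ.≤ ε) (sym (ℚ.+-inverseʳ q)) (ℚ.<⇒≤ 0<ε)

_-_ : ℝ → ℝ → ℝ
x - y = mkℝ (λ n → seq x n ℚ.- seq y n) isCauchy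
  where
  isCauchy : IsCauchy (λ n → seq x n ℚ.- seq y n)
  isCauchy ε 0<ε with cauchy x (½ ℚ.* ε) (0<½*ε 0<ε)
                    | cauchy y (½ ℚ.* ε) (0<½*ε 0<ε)
  ... | N₁ , p | N₂ , q = N₁ ℕ.⊔ N₂ , λ m n N≤m N≤n → begin
    ℚ.∣ (seq x m ℚ.- seq y m) ℚ.- (seq x n ℚ.- seq y n) ∣
      ≡⟨ cong ℚ.∣_∣ (solve 4
           (λ a b c d → (a :- b) :- (c :- d) := (a :- c) :- (b :- d))
           refl (seq x m) (seq y m) (seq x n) (seq y n)) ⟩
    ℚ.∣ (seq x m ℚ.- seq x n) ℚ.- (seq y m ℚ.- seq y n) ∣
      ≤⟨ ℚ.∣p-q∣≤∣p∣+∣q∣ (seq x m ℚ.- seq x n) (seq y m ℚ.- seq y n) ⟩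
    ℚ.∣ seq x m ℚ.- seq x n ∣ ℚ.+ ℚ.∣ seq y m ℚ.- seq y n ∣
      ≤⟨ ℚ.+-mono-≤
           (p m n (ℕ.m⊔n≤o⇒m≤o N₁ N₂ N≤m) (ℕ.m⊔n≤o⇒m≤o N₁ N₂ N≤n))
           (q m n (ℕ.m⊔n≤o⇒n≤o N₁ N₂ N≤m) (ℕ.m⊔n≤o⇒n≤o N₁ N₂ N≤n)) ⟩
    ½ ℚ.* ε ℚ.+ ½ ℚ.* ε
      ≡⟨ ½*ε+½*ε≡ε ε ⟩
    ε ∎
    where open ℚ.≤-Reasoning
          open ℚSolver.+-*-Solver

∣_∣ : ℝ → ℝ
∣ x ∣ = mkℝ (λ n → ℚ.∣ seq x n ∣) λ ε 0<ε →
  let N , p = cauchy x ε 0<ε in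
  N , λ m n N≤m N≤n →
    ℚ.≤-trans (∣∣p∣-∣q∣∣≤∣p-q∣ (seq x m) (seq x n)) (p m n N≤m N≤n)

_≤_ : ℝ → ℝ → Set
x ≤ y = ∀ ε → 0ℚ ℚ.< ε → ∃[ N ] (∀ n → N ℕ.≤ n → seq x n ℚ.≤ seq y n ℚ.+ ε)

_⟶_ : (ℕ → ℝ) → ℝ → Set
x ⟶ l = ∀ ε → 0ℚ ℚ.< ε → ∃[ N ] (∀ m → N ℕ.≤ m → ∣ x m - l ∣ ≤ fromℚ ε)

-- A real is the limit of the rational sequence that represents it.
seq⟶ : ∀ x → (λ m → fromℚ (seq x m)) ⟶ x
seq⟶ x ε 0<ε with cauchy x ε 0<ε
... | N , p = N , λ m N≤m δ 0<δ → N , λ n N≤n →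
  ℚ.≤-trans (p m n N≤m N≤n)
    (subst (ℚ._≤ ε ℚ.+ δ) (ℚ.+-identityʳ ε) (ℚ.+-monoʳ-≤ ε (ℚ.<⇒≤ 0<δ)))

------------------------------------------------------------------------
-- The Riemann zeta function at integers s > 1

1/_^_ : (n s : ℕ) .{{_ : NonZero n}} → ℚ
1/ n ^ s = (+ 1 / n ℕ.^ s) {{ℕ.m^n≢0 n s}}

ζ-partialSum : ℕ → ℕ → ℚ
ζ-partialSum s zero    = 0ℚ
ζ-partialSum s (suc N) = ζ-partialSum s N ℚ.+ 1/ suc N ^ s

private
  1/m≥0 : ∀ m .{{_ : NonZero m}} → 0ℚ ℚ.≤ + 1 / m
  1/m≥0 m = ℚ.nonNegative⁻¹ (+ 1 / m) {{ℚ.normalize-nonNeg 1 m}}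

  1/a+1/b≤1/c : ∀ a b c .{{_ : NonZero a}} .{{_ : NonZero b}} .{{_ : NonZero c}} →
                (b ℕ.+ a) ℕ.* c ℕ.≤ a ℕ.* b → + 1 / a ℚ.+ + 1 / b ℚ.≤ + 1 / c
  1/a+1/b≤1/c a@(suc a′) b@(suc b′) c@(suc c′) h = ℚ.toℚᵘ-cancel-≤ (begin
    ℚ.toℚᵘ (+ 1 / a ℚ.+ + 1 / b)
      ≃⟨ ℚ.toℚᵘ-homo-+ (+ 1 / a) (+ 1 / b) ⟩
    ℚ.toℚᵘ (+ 1 / a) ℚᵘ.+ ℚ.toℚᵘ (+ 1 / b)
      ≃⟨ ℚᵘ.+-cong (ℚ.toℚᵘ-fromℚᵘ (ℚᵘ.mkℚᵘ (+ 1) a′))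
                   (ℚ.toℚᵘ-fromℚᵘ (ℚᵘ.mkℚᵘ (+ 1) b′)) ⟩
    ℚᵘ.mkℚᵘ (+ 1) a′ ℚᵘ.+ ℚᵘ.mkℚᵘ (+ 1) b′
      ≤⟨ ℚᵘ.*≤* (ℤ.+≤+ (subst₂ ℕ._≤_
           (cong (ℕ._* c) (cong₂ ℕ._+_ (sym (ℕ.*-identityˡ b)) (sym (ℕ.*-identityˡ a))))
           (sym (ℕ.*-identityˡ (a ℕ.* b))) h)) ⟩
    ℚᵘ.mkℚᵘ (+ 1) c′
      ≃⟨ ℚ.toℚᵘ-fromℚᵘ (ℚᵘ.mkℚᵘ (+ 1) c′) ⟨
    ℚ.toℚᵘ (+ 1 / c) ∎)
    where open ℚᵘ.≤-Reasoning

  telescope : ∀ s n .{{_ : NonTrivial s}} .{{_ : NonZero n}} →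
              1/ suc n ^ s ℚ.+ + 1 / suc n ℚ.≤ + 1 / n
  telescope s n = 1/a+1/b≤1/c (N ℕ.^ s) N n {{ℕ.m^n≢0 N s}} (begin
    (N ℕ.+ N ℕ.^ s) ℕ.* n             ≡⟨ ℕ.*-distribʳ-+ n N (N ℕ.^ s) ⟩
    N ℕ.* n ℕ.+ N ℕ.^ s ℕ.* n         ≤⟨ ℕ.+-monoˡ-≤ (N ℕ.^ s ℕ.* n) N*n≤N^s ⟩
    N ℕ.^ s ℕ.+ N ℕ.^ s ℕ.* n         ≡⟨ ℕ.*-suc (N ℕ.^ s) n ⟨
    N ℕ.^ s ℕ.* N                     ∎)
    where
    open ℕ.≤-Reasoning
    N = suc n
    N*n≤N^s : N ℕ.* n ℕ.≤ N ℕ.^ s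
    N*n≤N^s = begin
      N ℕ.* n  ≤⟨ ℕ.*-monoʳ-≤ N (ℕ.n≤1+n n) ⟩
      N ℕ.* N  ≡⟨ cong (N ℕ.*_) (ℕ.*-identityʳ N) ⟨
      N ℕ.^ 2  ≤⟨ ℕ.^-monoʳ-≤ N (ℕ.nonTrivial⇒n>1 s) ⟩
      N ℕ.^ s  ∎

  module Tail (s N : ℕ) .{{_ : NonTrivial s}} .{{_ : NonZero N}} where
    S = ζ-partialSum s

    lower : ∀ k → S N ℚ.≤ S (k ℕ.+ N)
    lower zero    = ℚ.≤-refl
    lower (suc k) = ℚ.≤-trans (lower k) (subst (ℚ._≤ S (suc k ℕ.+ N))
      (ℚ.+-identityʳ (S (k ℕ.+ N)))
      (ℚ.+-monoʳ-≤ (S (k ℕ.+ N))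
        (1/m≥0 (suc (k ℕ.+ N) ℕ.^ s) {{ℕ.m^n≢0 (suc (k ℕ.+ N)) s}})))

    k+N≢0 : ∀ k → NonZero (k ℕ.+ N)
    k+N≢0 k = ℕ.≢-nonZero λ eq → ℕ.≢-nonZero⁻¹ N (ℕ.m+n≡0⇒n≡0 k eq)

    decreasing : ∀ k → S (k ℕ.+ N) ℚ.+ (+ 1 / (k ℕ.+ N)) {{k+N≢0 k}} ℚ.≤ S N ℚ.+ + 1 / N
    decreasing zero    = ℚ.≤-refl
    decreasing (suc k) = ℚ.≤-trans
      (subst (ℚ._≤ S (k ℕ.+ N) ℚ.+ (+ 1 / (k ℕ.+ N)) {{k+N≢0 k}})
        (sym (ℚ.+-assoc (S (k ℕ.+ N)) (1/ suc (k ℕ.+ N) ^ s) (+ 1 / suc (k ℕ.+ N))))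
        (ℚ.+-monoʳ-≤ (S (k ℕ.+ N)) (telescope s (k ℕ.+ N) {{it}} {{k+N≢0 k}})))
      (decreasing k)

    upper : ∀ k → S (k ℕ.+ N) ℚ.≤ S N ℚ.+ + 1 / N
    upper k = ℚ.≤-trans (subst (ℚ._≤ S (k ℕ.+ N) ℚ.+ (+ 1 / (k ℕ.+ N)) {{k+N≢0 k}})
      (ℚ.+-identityʳ (S (k ℕ.+ N)))
      (ℚ.+-monoʳ-≤ (S (k ℕ.+ N)) (1/m≥0 (k ℕ.+ N) {{k+N≢0 k}})))
      (decreasing k)

    half : ∀ m n → N ℕ.≤ m → N ℕ.≤ n → S m ℚ.- S n ℚ.≤ + 1 / N
    half m n N≤m N≤n = p≤q+r⇒p-q≤r (ℚ.≤-trans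
      (subst (λ t → S t ℚ.≤ S N ℚ.+ + 1 / N) (ℕ.m∸n+n≡m N≤m) (upper (m ℕ.∸ N)))
      (ℚ.+-monoˡ-≤ (+ 1 / N)
        (subst (λ t → S N ℚ.≤ S t) (ℕ.m∸n+n≡m N≤n) (lower (n ℕ.∸ N)))))

    close : ∀ m n → N ℕ.≤ m → N ℕ.≤ n → ℚ.∣ S m ℚ.- S n ∣ ℚ.≤ + 1 / N
    close m n N≤m N≤n = ∣p∣≤ (half m n N≤m N≤n) (subst (ℚ._≤ + 1 / N)
      (solve 2 (λ a b → b :- a := :- (a :- b)) refl (S m) (S n)) (half n m N≤n N≤m))
      where open ℚSolver.+-*-Solver

ζ-cauchy : ∀ s .{{_ : NonTrivial s}} → IsCauchy (ζ-partialSum s)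
ζ-cauchy s ε 0<ε = ↧ₙ ε , λ m n N≤m N≤n →
  ℚ.≤-trans (Tail.close s (↧ₙ ε) m n N≤m N≤n) (1/↧ε≤ε ε 0<ε)

ζ : (s : ℕ) .{{_ : NonTrivial s}} → ℝ
ζ s = mkℝ (ζ-partialSum s) (ζ-cauchy s)

------------------------------------------------------------------------
-- Matrices and their infinite products

Matrix : Set → ℕ → Set
Matrix A k = Vector (Vector A k) k

infixl 7 _⊗_

_⊗_ : ∀ {k} → Matrix ℚ k → Matrix ℚ k → Matrix ℚ k
(A ⊗ B) i j = sum ℚ.+-0-commutativeMonoid (λ l → A i l ℚ.* B l j)

identity : ∀ {k} → Matrix ℚ k
identity i j = if ⌊ i Fin.≟ j ⌋ then 1ℚ else 0ℚ

-- A sequence M₁, M₂, … of rational matrices is indexed by the nonzero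
-- naturals; partialProduct M m is M₁ ⊗ M₂ ⊗ ⋯ ⊗ Mₘ.
partialProduct : ∀ {k} → ((n : ℕ) .{{_ : NonZero n}} → Matrix ℚ k) → ℕ → Matrix ℚ k
partialProduct M zero    = identity
partialProduct M (suc m) = partialProduct M m ⊗ M (suc m)

-- The factors are rational, so the partial products are computed in ℚ; the
-- limit is taken entrywise in ℝ.
InfiniteProduct : ∀ {k} → ((n : ℕ) .{{_ : NonZero n}} → Matrix ℚ k) → Matrix ℝ k → Set
InfiniteProduct M L = ∀ i j → (λ m → fromℚ (partialProduct M m i j)) ⟶ L i j

factor : (n : ℕ) .{{_ : NonZero n}} → Matrix ℚ 2
factor n =
  (+ n / (2 ℕ.* (1 ℕ.+ 2 ℕ.* n)) ∷ (+ 3 / (2 ℕ.* n)) {{ℕ.m*n≢0 2 n}} ∷ []) ∷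
  (0ℚ                            ∷ 1ℚ                                ∷ []) ∷ []

limit : Matrix ℝ 2
limit =
  (fromℚ 0ℚ ∷ ζ 2      ∷ []) ∷
  (fromℚ 0ℚ ∷ fromℚ 1ℚ ∷ []) ∷ []

{-# OPTIONS --safe #-}

-- Let w i j = i! j! / (i+j+1)!, the Beta integral ∫₀¹ xⁱ(1-x)ʲ dx.  The
-- (0,0) entry of the n-th partial product is w n n, and the (0,1) entry is
-- exactly Σ_{k=1}^{n} 1/k² + Σ_{i<n} w i n / (i+1).  The second sum
-- telescopes against w i n = w i (n-1) - w (i+1) (n-1), so it is at most 1/n.

module Submission where

open import Data.Fin.Patterns using (0F; 1F)
open import Data.Integer.Base as ℤ using (+_)
import Data.Integer.Properties as ℤ
open import Data.Nat.Base as ℕ using (ℕ; zero; suc; NonZero)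
import Data.Nat.Properties as ℕ
open import Data.Product.Base using (_,_; proj₁; proj₂)
open import Data.Rational.Base using (ℚ; mkℚ; 0ℚ; 1ℚ; ½; _/_; ↧ₙ_; _+_; _*_; nonNegative; toℚᵘ)
import Data.Rational.Base as ℚ
import Data.Rational.Properties as ℚ
open import Data.Rational.Solver using (module +-*-Solver)
import Data.Rational.Unnormalised.Base as ℚᵘ
import Data.Rational.Unnormalised.Properties as ℚᵘ
open import Relation.Binary.PropositionalEquality
open import Relation.Nullary.Negation.Core using (contradiction)

open import Defs

open +-*-Solver

-- Fractions

ι : ℕ → ℚ
ι n = + n / 1

ι-+ : ∀ m n → ι (m ℕ.+ n) ≡ ι m + ι n
ι-+ m n = ℚ.toℚᵘ-injective (begin
  toℚᵘ (ι (m ℕ.+ n))                    ≈⟨ ℚ.toℚᵘ-fromℚᵘ (ℚᵘ.mkℚᵘ (+ (m ℕ.+ n)) 0) ⟩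
  ℚᵘ.mkℚᵘ (+ (m ℕ.+ n)) 0               ≈⟨ ℚᵘ.*≡* (cong (ℤ._* + 1) (sym (cong₂ ℤ._+_ (ℤ.*-identityʳ (+ m)) (ℤ.*-identityʳ (+ n))))) ⟩
  ℚᵘ.mkℚᵘ (+ m) 0 ℚᵘ.+ ℚᵘ.mkℚᵘ (+ n) 0  ≈⟨ ℚᵘ.+-cong (ℚ.toℚᵘ-fromℚᵘ (ℚᵘ.mkℚᵘ (+ m) 0)) (ℚ.toℚᵘ-fromℚᵘ (ℚᵘ.mkℚᵘ (+ n) 0)) ⟨
  toℚᵘ (ι m) ℚᵘ.+ toℚᵘ (ι n)            ≈⟨ ℚ.toℚᵘ-homo-+ (ι m) (ι n) ⟨
  toℚᵘ (ι m + ι n)                      ∎)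
  where open ℚᵘ.≃-Reasoning

ι-* : ∀ m n → ι (m ℕ.* n) ≡ ι m * ι n
ι-* zero    n = sym (ℚ.*-zeroˡ (ι n))
ι-* (suc m) n = begin
  ι (n ℕ.+ m ℕ.* n)   ≡⟨ ι-+ n (m ℕ.* n) ⟩
  ι n + ι (m ℕ.* n)   ≡⟨ cong (ι n ℚ.+_) (ι-* m n) ⟩
  ι n + ι m * ι n     ≡⟨ solve 2 (λ m n → n :+ m :* n := (con 1ℚ :+ m) :* n) refl (ι m) (ι n) ⟩
  (1ℚ + ι m) * ι n    ≡⟨ cong (_* ι n) (ι-+ 1 m) ⟨
  ι (suc m) * ι n     ∎
  where open ≡-Reasoning

-- `_/_` reduces to lowest terms, so a fraction with symbolic parts does not compute. The entries of
-- `factor` and the terms of `ζ` are therefore handled by clearing denominators with this law.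
/-*-cancel : ∀ p d .{{_ : NonZero d}} → (+ p / d) * ι d ≡ ι p
/-*-cancel p d@(suc d′) = ℚ.toℚᵘ-injective (begin
  toℚᵘ ((+ p / d) * ι d)                 ≈⟨ ℚ.toℚᵘ-homo-* (+ p / d) (ι d) ⟩
  toℚᵘ (+ p / d) ℚᵘ.* toℚᵘ (ι d)         ≈⟨ ℚᵘ.*-cong (ℚ.toℚᵘ-fromℚᵘ (ℚᵘ.mkℚᵘ (+ p) d′)) (ℚ.toℚᵘ-fromℚᵘ (ℚᵘ.mkℚᵘ (+ d) 0)) ⟩
  ℚᵘ.mkℚᵘ (+ p) d′ ℚᵘ.* ℚᵘ.mkℚᵘ (+ d) 0  ≈⟨ ℚᵘ.*≡* (trans (ℤ.*-identityʳ (+ p ℤ.* + d)) (cong (λ e → + p ℤ.* + e) (sym (ℕ.*-identityʳ d)))) ⟩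
  ℚᵘ.mkℚᵘ (+ p) 0                        ≈⟨ ℚ.toℚᵘ-fromℚᵘ (ℚᵘ.mkℚᵘ (+ p) 0) ⟨
  toℚᵘ (ι p)                             ∎)
  where open ℚᵘ.≃-Reasoning

1/1+ : ℕ → ℚ
1/1+ n = + 1 / suc n

1/1+-inverse : ∀ n → 1/1+ n * ι (suc n) ≡ 1ℚ
1/1+-inverse n = /-*-cancel 1 (suc n)

1/1+-nonNeg : ∀ n → 0ℚ ℚ.≤ 1/1+ n
1/1+-nonNeg n = ℚ.nonNegative⁻¹ (1/1+ n) {{ℚ.normalize-nonNeg 1 (suc n)}}

1/1+≤1 : ∀ n → 1/1+ n ℚ.≤ 1ℚ
1/1+≤1 n = ℚ.toℚᵘ-cancel-≤ (ℚᵘ.≤-trans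
  (ℚᵘ.≤-reflexive (ℚ.toℚᵘ-fromℚᵘ (ℚᵘ.mkℚᵘ (+ 1) n)))
  (ℚᵘ.*≤* (ℤ.+≤+ (ℕ.s≤s ℕ.z≤n))))

-- A positive rational has numerator at least 1, so it is no smaller than the reciprocal of its
-- denominator.
1/1+≤ε : ∀ ε → 0ℚ ℚ.< ε → ∀ m → ↧ₙ ε ℕ.≤ suc m → 1/1+ m ℚ.≤ ε
1/1+≤ε (mkℚ (+ suc p) d _) _ m d<1+m = ℚ.toℚᵘ-cancel-≤ (ℚᵘ.≤-trans
  (ℚᵘ.≤-reflexive (ℚ.toℚᵘ-fromℚᵘ (ℚᵘ.mkℚᵘ (+ 1) m)))
  (ℚᵘ.*≤* (ℤ.+≤+ (ℕ.*-mono-≤ {1} {suc p} (ℕ.s≤s ℕ.z≤n) d<1+m))))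
1/1+≤ε (mkℚ (+ zero) _ _) (ℚ.*<* (ℤ.+<+ ()))
1/1+≤ε (mkℚ ℤ.-[1+ _ ] _ _) (ℚ.*<* ())

ι-suc-*-cancelˡ : ∀ n {x y} → ι (suc n) * x ≡ ι (suc n) * y → x ≡ y
ι-suc-*-cancelˡ n {x} {y} eq = begin
  x                            ≡⟨ unit x ⟨
  1/1+ n * (ι (suc n) * x)     ≡⟨ cong (1/1+ n *_) eq ⟩
  1/1+ n * (ι (suc n) * y)     ≡⟨ unit y ⟩
  y                            ∎
  where
  open ≡-Reasoning
  unit : ∀ z → 1/1+ n * (ι (suc n) * z) ≡ z
  unit z = trans (sym (ℚ.*-assoc (1/1+ n) (ι (suc n)) z))
    (trans (cong (_* z) (1/1+-inverse n)) (ℚ.*-identityˡ z))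

*-nonNeg : ∀ {x y} → 0ℚ ℚ.≤ x → 0ℚ ℚ.≤ y → 0ℚ ℚ.≤ x * y
*-nonNeg {x} {y} 0≤x 0≤y = subst (ℚ._≤ x * y) (ℚ.*-zeroʳ x)
  (ℚ.*-monoˡ-≤-nonNeg x {{nonNegative 0≤x}} 0≤y)

≤-+-nonNeg : ∀ x {y} → 0ℚ ℚ.≤ y → x ℚ.≤ x + y
≤-+-nonNeg x {y} 0≤y = subst (ℚ._≤ x + y) (ℚ.+-identityʳ x) (ℚ.+-monoʳ-≤ x 0≤y)

-- The Beta function

-- The recursion is `x = 1 - (1-x)` under the integral, with base `∫₀¹ (1-x)ʲ dx`. Factorials are
-- avoided; the ratios of neighbouring values that they would give are `w-sucʳ` and `w-exchange`.
w : ℕ → ℕ → ℚ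
w zero    j = 1/1+ j
w (suc i) j = w i j ℚ.- w i (suc j)

w-split : ∀ i j → w i j ≡ w i (suc j) + w (suc i) j
w-split i j = solve 2 (λ a b → a := b :+ (a :- b)) refl (w i j) (w i (suc j))

-- The two ratios, with denominators cleared, are proved by mutual induction on `i`: `w-exchange` at
-- `i` needs `w-sucʳ` at `i`, and `w-sucʳ` at `suc i` needs both at `i`. The index `j` must stay
-- general, since `w-sucʳ` is also called at `suc j`.
w-sucʳ : ∀ i j → ι (suc i ℕ.+ suc j) * w i (suc j) ≡ ι (suc j) * w i j
w-exchange : ∀ i j → ι (suc j) * w (suc i) j ≡ ι (suc i) * w i (suc j)

w-exchange i j = begin
  b * (w i j ℚ.- w i (suc j))                    ≡⟨ solve 3 (λ b x y → b :* (x :- y) := b :* x :- b :* y) refl b (w i j) (w i (suc j)) ⟩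
  b * w i j ℚ.- b * w i (suc j)                  ≡⟨ cong (ℚ._- b * w i (suc j)) (w-sucʳ i j) ⟨
  ι (suc i ℕ.+ suc j) * w i (suc j) ℚ.- b * w i (suc j)
                                                 ≡⟨ cong (λ s → s * w i (suc j) ℚ.- b * w i (suc j)) (ι-+ (suc i) (suc j)) ⟩
  (a + b) * w i (suc j) ℚ.- b * w i (suc j)      ≡⟨ solve 3 (λ a b y → (a :+ b) :* y :- b :* y := a :* y) refl a b (w i (suc j)) ⟩
  a * w i (suc j)                                ∎
  where
  open ≡-Reasoning
  a = ι (suc i)
  b = ι (suc j)

w-sucʳ zero j = begin
  ι (suc (suc j)) * 1/1+ (suc j)   ≡⟨ ℚ.*-comm (ι (suc (suc j))) (1/1+ (suc j)) ⟩
  1/1+ (suc j) * ι (suc (suc j))   ≡⟨ 1/1+-inverse (suc j) ⟩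
  1ℚ                               ≡⟨ 1/1+-inverse j ⟨
  1/1+ j * ι (suc j)               ≡⟨ ℚ.*-comm (1/1+ j) (ι (suc j)) ⟩
  ι (suc j) * 1/1+ j               ∎
  where open ≡-Reasoning
w-sucʳ (suc i) j = begin
  ι (suc (suc i) ℕ.+ suc j) * (x ℚ.- y)          ≡⟨ cong (λ n → ι n * (x ℚ.- y)) (ℕ.+-suc (suc i) (suc j)) ⟨
  s * (x ℚ.- y)                                  ≡⟨ solve 3 (λ s x y → s :* (x :- y) := s :* x :- s :* y) refl s x y ⟩
  s * x ℚ.- s * y                                ≡⟨ cong (λ t → s * x ℚ.- t) (w-sucʳ i (suc j)) ⟩
  s * x ℚ.- b * x                                ≡⟨ cong (λ t → t * x ℚ.- b * x) (ι-+ (suc i) (suc (suc j))) ⟩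
  (a + b) * x ℚ.- b * x                          ≡⟨ solve 3 (λ a b x → (a :+ b) :* x :- b :* x := a :* x) refl a b x ⟩
  a * x                                          ≡⟨ w-exchange i j ⟨
  ι (suc j) * w (suc i) j                        ∎
  where
  open ≡-Reasoning
  a = ι (suc i)
  b = ι (suc (suc j))
  s = ι (suc i ℕ.+ suc (suc j))
  x = w i (suc j)
  y = w i (suc (suc j))

w-exchange′ : ∀ i j → w i (suc j) * 1/1+ j ≡ w (suc i) j * 1/1+ i
w-exchange′ i j = begin
  y * q                ≡⟨ solve 2 (λ y q → y :* q := con 1ℚ :* y :* q) refl y q ⟩
  1ℚ * y * q           ≡⟨ cong (λ e → e * y * q) (1/1+-inverse i) ⟨
  p * a * y * q        ≡⟨ solve 4 (λ p a y q → p :* a :* y :* q := p :* q :* (a :* y)) refl p a y q ⟩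
  p * q * (a * y)      ≡⟨ cong (p * q *_) (w-exchange i j) ⟨
  p * q * (b * z)      ≡⟨ solve 4 (λ p q b z → p :* q :* (b :* z) := q :* b :* (z :* p)) refl p q b z ⟩
  q * b * (z * p)      ≡⟨ cong (_* (z * p)) (1/1+-inverse j) ⟩
  1ℚ * (z * p)         ≡⟨ ℚ.*-identityˡ (z * p) ⟩
  z * p                ∎
  where
  open ≡-Reasoning
  a = ι (suc i)
  b = ι (suc j)
  p = 1/1+ i
  q = 1/1+ j
  y = w i (suc j)
  z = w (suc i) j

-- The recursion subtracts, so it does not show the sign. `w-exchange` makes `w (suc i) j` a
-- positive multiple of `w i (suc j)`, to which induction on `i` applies.
w-nonNeg : ∀ i j → 0ℚ ℚ.≤ w i j
w-nonNeg zero    j = 1/1+-nonNeg j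
w-nonNeg (suc i) j = subst (0ℚ ℚ.≤_) eq
  (*-nonNeg (*-nonNeg (1/1+-nonNeg j) (ι-nonNeg (suc i))) (w-nonNeg i (suc j)))
  where
  ι-nonNeg : ∀ n → 0ℚ ℚ.≤ ι n
  ι-nonNeg n = ℚ.nonNegative⁻¹ (ι n) {{ℚ.normalize-nonNeg n 1}}
  eq : 1/1+ j * ι (suc i) * w i (suc j) ≡ w (suc i) j
  eq = begin
    1/1+ j * ι (suc i) * w i (suc j)      ≡⟨ ℚ.*-assoc (1/1+ j) (ι (suc i)) (w i (suc j)) ⟩
    1/1+ j * (ι (suc i) * w i (suc j))    ≡⟨ cong (1/1+ j *_) (w-exchange i j) ⟨
    1/1+ j * (ι (suc j) * w (suc i) j)    ≡⟨ ℚ.*-assoc (1/1+ j) (ι (suc j)) (w (suc i) j) ⟨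
    1/1+ j * ι (suc j) * w (suc i) j      ≡⟨ cong (_* w (suc i) j) (1/1+-inverse j) ⟩
    1ℚ * w (suc i) j                      ≡⟨ ℚ.*-identityˡ (w (suc i) j) ⟩
    w (suc i) j                           ∎
    where open ≡-Reasoning

w-antitoneʳ : ∀ i j → w i (suc j) ℚ.≤ w i j
w-antitoneʳ i j = subst (w i (suc j) ℚ.≤_) (sym (w-split i j))
  (≤-+-nonNeg (w i (suc j)) (w-nonNeg (suc i) j))

w-antitoneˡ : ∀ i j → w (suc i) j ℚ.≤ w i j
w-antitoneˡ i j = subst (w (suc i) j ℚ.≤_)
  (trans (ℚ.+-comm (w (suc i) j) (w i (suc j))) (sym (w-split i j)))
  (≤-+-nonNeg (w (suc i) j) (w-nonNeg i (suc j)))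

w≤1/1+ : ∀ i j → w i j ℚ.≤ 1/1+ j
w≤1/1+ zero    j = ℚ.≤-refl
w≤1/1+ (suc i) j = ℚ.≤-trans (w-antitoneˡ i j) (w≤1/1+ i j)

-- On the diagonal `w-exchange` has equal coefficients, so the two parts in `w-split n n` coincide.
w-diagonal-half : ∀ n → w n (suc n) ≡ ½ * w n n
w-diagonal-half n = begin
  y                   ≡⟨ solve 1 (λ y → y := con ½ :* (y :+ y)) refl y ⟩
  ½ * (y + y)         ≡⟨ cong (λ t → ½ * (y + t)) (ι-suc-*-cancelˡ n (w-exchange n n)) ⟨
  ½ * (y + w (suc n) n) ≡⟨ cong (½ *_) (w-split n n) ⟨
  ½ * w n n           ∎
  where
  open ≡-Reasoning
  y = w n (suc n)

-- The correction term

-- `E n j` is `Σ_{i<n} w i j / (i+1)`. The length `n` and the index `j` are kept apart so that the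
-- step from `E m m` to `E (suc m) (suc m)` can raise them one at a time.
E : ℕ → ℕ → ℚ
E zero    j = 0ℚ
E (suc n) j = E n j + w n j * 1/1+ n

E-nonNeg : ∀ n j → 0ℚ ℚ.≤ E n j
E-nonNeg zero    j = ℚ.≤-refl
E-nonNeg (suc n) j = ℚ.≤-trans (E-nonNeg n j)
  (≤-+-nonNeg (E n j) (*-nonNeg (w-nonNeg n j) (1/1+-nonNeg n)))

-- The remainder `w n j` is carried along so that the induction closes: `w-split` gives
-- `w n (suc j) + w (suc n) j = w n j`, once the weight `1/(n+1)` is bounded by 1.
E-telescope : ∀ n j → E n (suc j) + w n j ℚ.≤ 1/1+ j
E-telescope zero    j = ℚ.≤-reflexive (ℚ.+-identityˡ (1/1+ j))
E-telescope (suc n) j = begin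
  E n (suc j) + w n (suc j) * 1/1+ n + w (suc n) j   ≤⟨ ℚ.+-monoˡ-≤ (w (suc n) j) (ℚ.+-monoʳ-≤ (E n (suc j)) shrink) ⟩
  E n (suc j) + w n (suc j) + w (suc n) j            ≡⟨ ℚ.+-assoc (E n (suc j)) (w n (suc j)) (w (suc n) j) ⟩
  E n (suc j) + (w n (suc j) + w (suc n) j)          ≡⟨ cong (E n (suc j) ℚ.+_) (w-split n j) ⟨
  E n (suc j) + w n j                                ≤⟨ E-telescope n j ⟩
  1/1+ j                                             ∎
  where
  open ℚ.≤-Reasoning
  shrink : w n (suc j) * 1/1+ n ℚ.≤ w n (suc j)
  shrink = subst (w n (suc j) * 1/1+ n ℚ.≤_) (ℚ.*-identityʳ (w n (suc j)))
    (ℚ.*-monoˡ-≤-nonNeg (w n (suc j)) {{nonNegative (w-nonNeg n (suc j))}} (1/1+≤1 n))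

E≤1/1+ : ∀ n j → E n (suc j) ℚ.≤ 1/1+ j
E≤1/1+ n j = ℚ.≤-trans (≤-+-nonNeg (E n (suc j)) (w-nonNeg n j)) (E-telescope n j)

-- This is the source of the terms `1/k²`. Raising `j` lowers the `i`-th term by
-- `w (suc i) j / (i+1)`, which equals `w i (suc j) / (j+1)` and so `(w i j - w (suc i) j) / (j+1)`.
-- The sum telescopes, and its upper end is `w 0 j / (j+1) = 1/(j+1)²`.
E-sucʳ : ∀ n j → E n (suc j) + 1/1+ j * 1/1+ j ≡ E n j + w n j * 1/1+ j
E-sucʳ zero    j = refl
E-sucʳ (suc n) j = begin
  e′ + y * p + q * q           ≡⟨ solve 4 (λ e y p q → e :+ y :* p :+ q :* q := (e :+ q :* q) :+ y :* p) refl e′ y p q ⟩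
  (e′ + q * q) + y * p         ≡⟨ cong (_+ y * p) (E-sucʳ n j) ⟩
  (e + x * q) + y * p          ≡⟨ cong (λ t → (e + t * q) + y * p) (w-split n j) ⟩
  (e + (y + z) * q) + y * p    ≡⟨ solve 5 (λ e y z p q → (e :+ (y :+ z) :* q) :+ y :* p := (e :+ y :* p :+ z :* q) :+ y :* q) refl e y z p q ⟩
  (e + y * p + z * q) + y * q  ≡⟨ cong ((e + y * p + z * q) ℚ.+_) (w-exchange′ n j) ⟩
  (e + y * p + z * q) + z * p  ≡⟨ solve 5 (λ e y z p q → (e :+ y :* p :+ z :* q) :+ z :* p := e :+ (y :+ z) :* p :+ z :* q) refl e y z p q ⟩
  e + (y + z) * p + z * q      ≡⟨ cong (λ t → e + t * p + z * q) (w-split n j) ⟨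
  e + x * p + z * q            ∎
  where
  open ≡-Reasoning
  e = E n j
  e′ = E n (suc j)
  x = w n j
  y = w n (suc j)
  z = w (suc n) j
  p = 1/1+ n
  q = 1/1+ j

-- The entries of the partial products

private
  P : ℕ → Matrix ℚ 2
  P = partialProduct factor

factor₀₀ : ∀ n .{{_ : NonZero n}} → factor n 0F 0F * (ι 2 * ι (1 ℕ.+ 2 ℕ.* n)) ≡ ι n
factor₀₀ n = trans (cong (factor n 0F 0F *_) (sym (ι-* 2 (1 ℕ.+ 2 ℕ.* n))))
  (/-*-cancel n (2 ℕ.* (1 ℕ.+ 2 ℕ.* n)))

factor₀₁ : ∀ n → factor (suc n) 0F 1F ≡ ι 3 * ½ * 1/1+ n
factor₀₁ n = begin
  f                                 ≡⟨ solve 1 (λ f → f := f :* con ½ :* (con (ι 2) :* con 1ℚ)) refl f ⟩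
  f * ½ * (ι 2 * 1ℚ)                ≡⟨ cong (λ t → f * ½ * (ι 2 * t)) (1/1+-inverse n) ⟨
  f * ½ * (ι 2 * (1/1+ n * ι (suc n)))
    ≡⟨ solve 5 (λ f h t r s → f :* h :* (t :* (r :* s)) := f :* (t :* s) :* h :* r) refl f ½ (ι 2) (1/1+ n) (ι (suc n)) ⟩
  f * (ι 2 * ι (suc n)) * ½ * 1/1+ n ≡⟨ cong (λ t → f * t * ½ * 1/1+ n) (ι-* 2 (suc n)) ⟨
  f * ι (2 ℕ.* suc n) * ½ * 1/1+ n  ≡⟨ cong (λ t → t * ½ * 1/1+ n) (/-*-cancel 3 (2 ℕ.* suc n)) ⟩
  ι 3 * ½ * 1/1+ n                  ∎
  where
  open ≡-Reasoning
  f = factor (suc n) 0F 1F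

1/^2 : ∀ n → 1/ suc n ^ 2 ≡ 1/1+ n * 1/1+ n
1/^2 n = begin
  f                                 ≡⟨ solve 1 (λ f → f := f :* (con 1ℚ :* con 1ℚ)) refl f ⟩
  f * (1ℚ * 1ℚ)                     ≡⟨ cong (λ t → f * (t * t)) (1/1+-inverse n) ⟨
  f * ((r * s) * (r * s))           ≡⟨ solve 3 (λ f r s → f :* ((r :* s) :* (r :* s)) := f :* (s :* (s :* con 1ℚ)) :* (r :* r)) refl f r s ⟩
  f * (s * (s * 1ℚ)) * (r * r)      ≡⟨ cong (λ t → f * (s * t) * (r * r)) (ι-* (suc n) 1) ⟨
  f * (s * ι (suc n ℕ.* 1)) * (r * r) ≡⟨ cong (λ t → f * t * (r * r)) (ι-* (suc n) (suc n ℕ.* 1)) ⟨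
  f * ι (suc n ℕ.^ 2) * (r * r)     ≡⟨ cong (_* (r * r)) (/-*-cancel 1 (suc n ℕ.^ 2)) ⟩
  1ℚ * (r * r)                      ≡⟨ ℚ.*-identityˡ (r * r) ⟩
  r * r                             ∎
  where
  open ≡-Reasoning
  f = 1/ suc n ^ 2
  r = 1/1+ n
  s = ι (suc n)

-- The path from `(n, n)` to `(n+1, n+1)` goes through `(n, n+1)`, which costs the factor 1/2, then
-- `(n+1, n)` by exchange, then `w-sucʳ`, which supplies `(n+1)/(2n+3)`.
w-diagonal-step : ∀ n → w n n * factor (suc n) 0F 0F ≡ w (suc n) (suc n)
w-diagonal-step n = ι-suc-*-cancelˡ (2 ℕ.* suc n) (begin
  d * (x * f)                     ≡⟨ solve 3 (λ d x f → d :* (x :* f) := con ½ :* x :* (f :* (con (ι 2) :* d))) refl d x f ⟩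
  ½ * x * (f * (ι 2 * d))         ≡⟨ cong (½ * x *_) (factor₀₀ (suc n)) ⟩
  ½ * x * ι (suc n)               ≡⟨ cong (_* ι (suc n)) (w-diagonal-half n) ⟨
  w n (suc n) * ι (suc n)         ≡⟨ ℚ.*-comm (w n (suc n)) (ι (suc n)) ⟩
  ι (suc n) * w n (suc n)         ≡⟨ w-exchange n n ⟨
  ι (suc n) * w (suc n) n         ≡⟨ w-sucʳ (suc n) n ⟨
  ι (suc (suc n) ℕ.+ suc n) * w (suc n) (suc n)
    ≡⟨ cong (λ t → ι (suc (suc n ℕ.+ t)) * w (suc n) (suc n)) (ℕ.+-identityʳ (suc n)) ⟨
  d * w (suc n) (suc n)           ∎)
  where
  open ≡-Reasoning
  d = ι (1 ℕ.+ 2 ℕ.* suc n)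
  x = w n n
  f = factor (suc n) 0F 0F

P₀₀ : ∀ m → P m 0F 0F ≡ w m m
P₀₀ zero    = refl
P₀₀ (suc m) = begin
  P m 0F 0F * f + (P m 0F 1F * 0ℚ + 0ℚ)   ≡⟨ solve 3 (λ a b f → a :* f :+ (b :* con 0ℚ :+ con 0ℚ) := a :* f) refl (P m 0F 0F) (P m 0F 1F) f ⟩
  P m 0F 0F * f                           ≡⟨ cong (_* f) (P₀₀ m) ⟩
  w m m * f                               ≡⟨ w-diagonal-step m ⟩
  w (suc m) (suc m)                       ∎
  where
  open ≡-Reasoning
  f = factor (suc m) 0F 0F

P₀₁ : ∀ m → P m 0F 1F ≡ ζ-partialSum 2 m + E m m
P₀₁ zero    = refl
P₀₁ (suc m) = begin
  P m 0F 0F * factor (suc m) 0F 1F + (P m 0F 1F * 1ℚ + 0ℚ)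
    ≡⟨ cong₂ (λ a b → a * factor (suc m) 0F 1F + (b * 1ℚ + 0ℚ)) (P₀₀ m) (P₀₁ m) ⟩
  x * factor (suc m) 0F 1F + ((S + e) * 1ℚ + 0ℚ)
    ≡⟨ cong (λ f → x * f + ((S + e) * 1ℚ + 0ℚ)) (factor₀₁ m) ⟩
  x * (ι 3 * ½ * r) + ((S + e) * 1ℚ + 0ℚ)
    -- Split 3/2 as 1 + 1/2. The whole part is what `E-sucʳ m m` trades for raising `j` and gaining
    -- `1/(m+1)²`; the half part is `w m (suc m) / (m+1)`, the last term of `E (suc m) (suc m)`.
    ≡⟨ solve 4 (λ x r S e → x :* (con (ι 3) :* con ½ :* r) :+ ((S :+ e) :* con 1ℚ :+ con 0ℚ)
                          := S :+ (e :+ x :* r) :+ con ½ :* x :* r) refl x r S e ⟩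
  S + (e + x * r) + ½ * x * r
    ≡⟨ cong₂ (λ t y → S + t + y * r) (E-sucʳ m m) (w-diagonal-half m) ⟨
  S + (e′ + r * r) + y * r
    ≡⟨ cong (λ t → S + (e′ + t) + y * r) (1/^2 m) ⟨
  S + (e′ + s) + y * r
    ≡⟨ solve 4 (λ S e s t → S :+ (e :+ s) :+ t := (S :+ s) :+ (e :+ t)) refl S e′ s (y * r) ⟩
  (S + s) + (e′ + y * r) ∎
  where
  open ≡-Reasoning
  x = w m m
  y = w m (suc m)
  r = 1/1+ m
  s = 1/ suc m ^ 2
  S = ζ-partialSum 2 m
  e = E m m
  e′ = E m (suc m)

P₁₀ : ∀ m → P m 1F 0F ≡ 0ℚ
P₁₀ zero    = refl
P₁₀ (suc m) = trans (cong (λ a → a * f + (P m 1F 1F * 0ℚ + 0ℚ)) (P₁₀ m))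
  (solve 2 (λ f b → con 0ℚ :* f :+ (b :* con 0ℚ :+ con 0ℚ) := con 0ℚ) refl f (P m 1F 1F))
  where f = factor (suc m) 0F 0F

P₁₁ : ∀ m → P m 1F 1F ≡ 1ℚ
P₁₁ zero    = refl
P₁₁ (suc m) = trans (cong₂ (λ a b → a * f + (b * 1ℚ + 0ℚ)) (P₁₀ m) (P₁₁ m))
  (solve 1 (λ f → con 0ℚ :* f :+ (con 1ℚ :* con 1ℚ :+ con 0ℚ) := con 1ℚ) refl f)
  where f = factor (suc m) 0F 1F

-- Convergence

-- Half of `ε` pays for the distance between two late terms of `seq l`, by its Cauchy property, and
-- half for `d`. The bounds on `d` start at index 1, where `1/m` makes sense.
⟶-perturb : ∀ (x d : ℕ → ℚ) (l : ℝ) → (∀ m → x m ≡ seq l m + d m) →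
            (∀ m → 0ℚ ℚ.≤ d (suc m)) → (∀ m → d (suc m) ℚ.≤ 1/1+ m) →
            (λ m → fromℚ (x m)) ⟶ l
⟶-perturb x d l x≡l+d 0≤d d≤ ε 0<ε = N ℕ.⊔ ↧ₙ (½ * ε) , λ where
    -- A denominator is a successor, so the threshold is at least 1 and index 0 never occurs.
    zero N≤0 → contradiction (ℕ.m⊔n≤o⇒n≤o N _ N≤0) λ ()
    (suc m) N≤1+m δ 0<δ → N , λ n N≤n → bound m n
      (ℕ.m⊔n≤o⇒m≤o N _ N≤1+m) (ℕ.m⊔n≤o⇒n≤o N _ N≤1+m) N≤n δ 0<δ
  where
  0<½ε : 0ℚ ℚ.< ½ * ε
  0<½ε = subst (ℚ._< ½ * ε) (ℚ.*-zeroʳ ½) (ℚ.*-monoʳ-<-pos ½ 0<ε)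

  N = proj₁ (cauchy l (½ * ε) 0<½ε)
  close = proj₂ (cauchy l (½ * ε) 0<½ε)

  bound : ∀ m n → N ℕ.≤ suc m → ↧ₙ (½ * ε) ℕ.≤ suc m → N ℕ.≤ n → ∀ δ → 0ℚ ℚ.< δ →
          ℚ.∣ x (suc m) ℚ.- seq l n ∣ ℚ.≤ ε + δ
  bound m n N≤1+m D≤1+m N≤n δ 0<δ = begin
    ℚ.∣ x (suc m) ℚ.- seq l n ∣
      ≡⟨ cong (λ t → ℚ.∣ t ℚ.- seq l n ∣) (x≡l+d (suc m)) ⟩
    ℚ.∣ seq l (suc m) + d (suc m) ℚ.- seq l n ∣
      ≡⟨ cong ℚ.∣_∣ (solve 3 (λ a b c → a :+ b :- c := (a :- c) :+ b) refl (seq l (suc m)) (d (suc m)) (seq l n)) ⟩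
    ℚ.∣ (seq l (suc m) ℚ.- seq l n) + d (suc m) ∣
      ≤⟨ ℚ.∣p+q∣≤∣p∣+∣q∣ (seq l (suc m) ℚ.- seq l n) (d (suc m)) ⟩
    ℚ.∣ seq l (suc m) ℚ.- seq l n ∣ + ℚ.∣ d (suc m) ∣
      ≡⟨ cong (ℚ.∣ seq l (suc m) ℚ.- seq l n ∣ ℚ.+_) (ℚ.0≤p⇒∣p∣≡p (0≤d m)) ⟩
    ℚ.∣ seq l (suc m) ℚ.- seq l n ∣ + d (suc m)
      ≤⟨ ℚ.+-mono-≤ (close (suc m) n N≤1+m N≤n)
           (ℚ.≤-trans (d≤ m) (1/1+≤ε (½ * ε) 0<½ε m D≤1+m)) ⟩
    ½ * ε + ½ * ε
      ≡⟨ solve 1 (λ ε → con ½ :* ε :+ con ½ :* ε := ε) refl ε ⟩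
    ε
      ≤⟨ ≤-+-nonNeg ε (ℚ.<⇒≤ 0<δ) ⟩
    ε + δ ∎
    where open ℚ.≤-Reasoning

⟶-const : ∀ (x : ℕ → ℚ) c → (∀ m → x m ≡ c) → (λ m → fromℚ (x m)) ⟶ fromℚ c
⟶-const x c x≡c = ⟶-perturb x (λ _ → 0ℚ) (fromℚ c)
  (λ m → trans (x≡c m) (sym (ℚ.+-identityʳ c))) (λ _ → ℚ.≤-refl) 1/1+-nonNeg

theorem6p1 : InfiniteProduct factor limit
theorem6p1 0F 0F = ⟶-perturb (λ m → P m 0F 0F) (λ m → w m m) (fromℚ 0ℚ)
  (λ m → trans (P₀₀ m) (sym (ℚ.+-identityˡ (w m m))))
  (λ m → w-nonNeg (suc m) (suc m))
  -- Lowering the second index first makes the bound `1/(m+1)`, as required, instead of `1/(m+2)`.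
  (λ m → ℚ.≤-trans (w-antitoneʳ (suc m) m) (w≤1/1+ (suc m) m))
theorem6p1 0F 1F = ⟶-perturb (λ m → P m 0F 1F) (λ m → E m m) (ζ 2) P₀₁
  (λ m → E-nonNeg (suc m) (suc m)) (λ m → E≤1/1+ (suc m) m)
theorem6p1 1F 0F = ⟶-const (λ m → P m 1F 0F) 0ℚ P₁₀
theorem6p1 1F 1F = ⟶-const (λ m → P m 1F 1F) 1ℚ P₁₁
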